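{- Let $G=(V,A)$ be a simple directed graph on vertices $V=\{1,\dots,n\}$. Let $\mathbb{K}$ be a field whose characteristic does not divide $n$ and let $\omega\in\mathbb{K}$ be a primitive $n$-th root of unity. Consider the following system in $\mathbb{K}[x_1,\dots,x_n]$: $$H_G=\Big\{x_i^n-1=0,\ \ \prod_{j\in\delta^+(i)}(\omega x_i-x_j)=0\ :\ i\in V\Big\}.$$ The system $H_G$ has a solution over the algebraic closure $\overline{\mathbb{K}}$ if and only if $G$ has a Hamiltonian cycle.
   Context: Simple directed graph: no loops and no repeated arcs (both $(i,j)$ and $(j,i)$ may be present). $\delta^+(i)$ is the set of vertices $j$ such that $(i,j)\in A$; an empty product equals $1$. A Hamiltonian cycle is an ordering $v_1,\dots,v_n$ of all the vertices such that $(v_1,v_2),(v_2,v_3),\dots,(v_{n-1},v_n),(v_n,v_1)\in A$. -}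

module Defs where

open import Level using (Level; 0ℓ; _⊔_) renaming (suc to lsuc)
open import Algebra.Bundles using (CommutativeRing; Semiring)
open import Algebra.Apartness.Bundles using (HeytingField; HeytingCommutativeRing)
open import Algebra.Morphism.Structures using (module RingMorphisms)
import Algebra.Definitions.RawSemiring as RawSemiringDefs
open import Data.Fin.Base using (Fin; toℕ; fromℕ)
open import Data.Fin.Permutation using (Permutation′; _⟨$⟩ʳ_)
open import Data.List.Base using (List; map; foldr; filter; allFin; _++_)
open import Data.List.Relation.Unary.All using (All)
open import Data.Nat.Base using (ℕ; zero; suc; _<_)
open import Data.Nat.Divisibility using (_∣_)
open import Data.Product.Base using (∃-syntax; Σ-syntax; _×_)
open import Data.Vec.Base using (Vec)
open import Data.Vec.Functional using (Vector)
open import Function.Bundles using (_⇔_)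
open import Relation.Binary.Core using (Rel)
open import Relation.Binary.Definitions using (Decidable; Irreflexive)
open import Relation.Binary.PropositionalEquality using (_≡_)
open import Relation.Nullary.Negation using (¬_)
open import Tactic.RingSolver.Core.Expression using (Expr; Κ; Ι; _⊕_; _⊗_; _⊛_; ⊝_; module Eval)

private
  variable
    c ℓ₁ ℓ₂ : Level

-- The vertex set {1,…,n} is Fin n.  The arc set is a decidable relation, so
-- both (i , j) and (j , i) may be arcs, and an arc cannot be repeated.
record SimpleDigraph (n : ℕ) : Set₁ where
  field
    Arc      : Rel (Fin n) 0ℓ
    arc?     : Decidable Arc
    loopless : Irreflexive _≡_ Arc

  δ⁺ : Fin n → List (Fin n)
  δ⁺ i = filter (arc? i) (allFin n)

-- The ordering v₁,…,vₙ of all the vertices is a permutation of Fin n.  The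
-- last conjunct is the closing arc (vₙ , v₁).
HamiltonianCycle : ∀ {n} → SimpleDigraph n → Set
HamiltonianCycle {n} G = Σ[ v ∈ Permutation′ n ]
    (∀ k l → toℕ l ≡ suc (toℕ k) → Arc (v ⟨$⟩ʳ k) (v ⟨$⟩ʳ l))
  × (∀ k l → suc (toℕ k) ≡ n → toℕ l ≡ 0 → Arc (v ⟨$⟩ʳ k) (v ⟨$⟩ʳ l))
  where open SimpleDigraph G

-- Fields are the library's Heyting fields: x # y holds exactly when x - y is
-- invertible, and ¬ x # y exactly when x ≈ y.  Hence x # 0# is the
-- constructive form of "x is nonzero".
module FieldNotions (K : HeytingField c ℓ₁ ℓ₂) where
  open HeytingField K public
  open CommutativeRing
    (HeytingCommutativeRing.commutativeRing heytingCommutativeRing) public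
    using (rawRing; semiring)
  open RawSemiringDefs (Semiring.rawSemiring semiring) public
    using (_^_; sum) renaming (_×_ to _·_)

  -- ℕp is the kernel of m ↦ m · 1; p = 0 is characteristic zero, since
  -- 0 ∣ m holds only for m ≡ 0.
  HasCharacteristic : ℕ → Set ℓ₁
  HasCharacteristic p = ∀ m → (m · 1# ≈ 0#) ⇔ (p ∣ m)

  PrimitiveRootOfUnity : ℕ → Carrier → Set ℓ₁
  PrimitiveRootOfUnity n ω =
    ω ^ n ≈ 1# × (∀ k → 0 < k → k < n → ¬ ω ^ k ≈ 1#)

  -- The value at x of the univariate polynomial Σᵢ aᵢ Xⁱ.
  eval : ∀ {d} → Vector Carrier d → Carrier → Carrier
  eval a x = sum (λ i → a i * x ^ toℕ i)

  -- Polynomials of degree d + 1 ≥ 1, with leading coefficient a (fromℕ (suc d)).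
  AlgebraicallyClosed : Set (c ⊔ ℓ₁ ⊔ ℓ₂)
  AlgebraicallyClosed =
    ∀ d (a : Vector Carrier (suc (suc d))) → a (fromℕ (suc d)) # 0# →
    ∃[ x ] eval a x ≈ 0#

record AlgebraicClosure (K : HeytingField c ℓ₁ ℓ₂) (c′ ℓ₁′ ℓ₂′ : Level)
       : Set (c ⊔ ℓ₁ ⊔ ℓ₂ ⊔ lsuc (c′ ⊔ ℓ₁′ ⊔ ℓ₂′)) where
  private module K = FieldNotions K
  field
    K̄ : HeytingField c′ ℓ₁′ ℓ₂′
  private module L = FieldNotions K̄
  open RingMorphisms K.rawRing L.rawRing using (IsRingHomomorphism)
  field
    ι                   : K.Carrier → L.Carrier
    isRingHomomorphism  : IsRingHomomorphism ι
    algebraicallyClosed : L.AlgebraicallyClosed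
    algebraic           : ∀ y → ∃[ d ] Σ[ a ∈ Vector K.Carrier d ]
      (∃[ i ] a i K.# K.0#) × L.eval (λ i → ι (a i)) y L.≈ L.0#

-- Elements of K[x₁,…,xₙ] are presented by ring expressions: Κ a is the constant
-- a and Ι i is the variable xᵢ.
Polynomial : HeytingField c ℓ₁ ℓ₂ → ℕ → Set c
Polynomial K n = Expr (HeytingField.Carrier K) n

module _ (K : HeytingField c ℓ₁ ℓ₂) where
  open HeytingField K using (Carrier; 1#)

  ∏ : ∀ {n} → List (Polynomial K n) → Polynomial K n
  ∏ = foldr _⊗_ (Κ 1#)

  -- The left-hand sides of the equations of H_G.
  H : ∀ {n} → SimpleDigraph n → Carrier → List (Polynomial K n)
  H {n} G ω =
       map (λ i → Ι i ⊛ n ⊕ ⊝ Κ 1#) (allFin n)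
    ++ map (λ i → ∏ (map (λ j → Κ ω ⊗ Ι i ⊕ ⊝ Ι j) (δ⁺ i))) (allFin n)
    where open SimpleDigraph G

HasSolutionOver : ∀ {c′ ℓ₁′ ℓ₂′ n} {K : HeytingField c ℓ₁ ℓ₂} →
                  AlgebraicClosure K c′ ℓ₁′ ℓ₂′ →
                  List (Polynomial K n) → Set (c ⊔ c′ ⊔ ℓ₁′)
HasSolutionOver C fs = ∃[ x ] All (λ f → ⟦ f ⟧ x ≈ 0#) fs
  where
  open AlgebraicClosure C
  open FieldNotions K̄
  open Eval rawRing ι using (⟦_⟧)

{-# OPTIONS --safe #-}

-- Along a solution x, every vertex i has an out-neighbour s i with
-- x (s i) = ω (x i), so k steps of s multiply the value by ωᵏ.  As the values
-- are invertible and ω is primitive, s never returns to a vertex in fewer than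
-- n steps, and its orbit is a Hamiltonian cycle.  Conversely ωᵏ is put on the
-- k-th vertex of a cycle.
--
-- Equality in a Heyting field is only stable, not decidable, so the successor s
-- exists only under a double negation; this is discharged at the very end
-- because having a Hamiltonian cycle is a decidable property of G.
module Submission where

open import Defs
open import Level using (Level)
open import Algebra.Apartness.Bundles using (HeytingField; HeytingCommutativeRing)
import Algebra.Apartness.Properties.HeytingCommutativeRing as HeytingProperties
open import Algebra.Bundles using (CommutativeRing; Semiring)
open import Algebra.Morphism.Structures using (module RingMorphisms)
import Algebra.Properties.Monoid.Mult.TCOptimised as MultProperties
import Algebra.Properties.Ring as RingProperties
import Algebra.Properties.Semiring.Exp as ExpProperties
open import Data.Fin.Base using (Fin; zero; suc; toℕ; fromℕ<; finToFun; funToFin)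
open import Data.Fin.Permutation
  using (permutation; _⟨$⟩ʳ_; _⟨$⟩ˡ_; inverseˡ; inverseʳ)
open import Data.Fin.Properties
  using (_≟_; all?; any?; injective⇒≤; toℕ-injective; toℕ<n;
         toℕ-fromℕ<; finToFun-funToFin; sequence)
open import Data.List.Base using (List; []; _∷_; map; allFin)
open import Data.List.Membership.Propositional using (lose; find)
open import Data.List.Membership.Propositional.Properties
  using (∈-allFin; ∈-filter⁺; ∈-filter⁻)
open import Data.List.Relation.Unary.All as All using (All)
import Data.List.Relation.Unary.All.Properties as All
open import Data.List.Relation.Unary.Any using (Any; here; there)
import Data.List.Relation.Unary.Any.Properties as Any
open import Data.Nat.Base as ℕ using (ℕ; zero; suc; _<_; _∸_; NonZero)
open import Data.Nat.Divisibility using (_∣_; _∣0)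
open import Data.Nat.GeneralisedArithmetic using (fold)
import Data.Nat.Properties as ℕ
open import Data.Product.Base using (∃; ∃-syntax; _×_; _,_; proj₁; proj₂)
open import Data.Sum.Base using (inj₁; inj₂)
open import Data.Vec.Base using (Vec; lookup; tabulate)
open import Data.Vec.Properties using (lookup∘tabulate)
open import Effect.Monad using (RawMonad)
open import Function.Base using (_∘_; case_of_)
open import Function.Bundles using (_⇔_; mk⇔)
open import Function.Definitions using (Injective)
open import Relation.Binary.Definitions using (tri<; tri≈; tri>)
open import Relation.Binary.PropositionalEquality as ≡
  using (_≡_; _≢_; _≗_; cong; subst; subst₂)
import Relation.Binary.Reasoning.Setoid as ≈-Reasoning
open import Relation.Nullary.Decidable
  using (Dec; yes; no; map′; _×-dec_; _→-dec_; decidable-stable)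
open import Relation.Nullary.Negation
  using (¬_; contradiction; ¬¬-map; ¬¬-Monad)
open import Tactic.RingSolver.Core.Expression using (Κ; Ι; _⊕_; _⊗_; _⊛_; ⊝_; module Eval)

private
  variable
    c ℓ₁ ℓ₂ c′ ℓ₁′ ℓ₂′ : Level
    n : ℕ

-- Injections of a finite set.

-- A missed value `y` would extend `f` to an injection `g` from n + 1 elements into n, against the
-- pigeonhole principle.
injective⇒surjective : {f : Fin n → Fin n} → Injective _≡_ _≡_ f →
                       ∀ y → ∃[ x ] f x ≡ y
injective⇒surjective {n} {f} f-inj y with any? (λ x → f x ≟ y)
... | yes x,fx≡y = x,fx≡y
... | no  y∉im   = contradiction (injective⇒≤ g-inj) ℕ.1+n≰n
  where
  g : Fin (suc n) → Fin n
  g zero    = y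
  g (suc x) = f x

  g-inj : Injective _≡_ _≡_ g
  g-inj {zero}  {zero}  _  = ≡.refl
  g-inj {zero}  {suc x} eq = contradiction (x , ≡.sym eq) y∉im
  g-inj {suc x} {zero}  eq = contradiction (x , eq) y∉im
  g-inj {suc x} {suc z} eq = cong suc (f-inj eq)

-- Hamiltonian cycles: decidability, and construction from an orbit.

module _ (G : SimpleDigraph n) where
  open SimpleDigraph G

  -- The arc conditions of `HamiltonianCycle`, detached from the permutation so that plain functions
  -- can be tested.
  Traverses : (Fin n → Fin n) → Set
  Traverses f =
      (∀ k l → toℕ l ≡ suc (toℕ k) → Arc (f k) (f l))
    × (∀ k l → suc (toℕ k) ≡ n → toℕ l ≡ 0 → Arc (f k) (f l))

  traverses? : ∀ f → Dec (Traverses f)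
  traverses? f =
          all? (λ k → all? λ l →
            (toℕ l ℕ.≟ suc (toℕ k)) →-dec arc? (f k) (f l))
    ×-dec all? (λ k → all? λ l →
            (suc (toℕ k) ℕ.≟ n) →-dec ((toℕ l ℕ.≟ 0) →-dec arc? (f k) (f l)))

  -- Serves the coding of functions by numbers, where decoding recovers a function only pointwise.
  traverses-resp-≗ : ∀ {f g} → f ≗ g → Traverses f → Traverses g
  traverses-resp-≗ f≗g (steps , closing) =
      (λ k l e → subst₂ Arc (f≗g k) (f≗g l) (steps k l e))
    , (λ k l e e₀ → subst₂ Arc (f≗g k) (f≗g l) (closing k l e e₀))

  injective-traversal⇒cycle : ∀ {f} → Injective _≡_ _≡_ f → Traverses f →
                              HamiltonianCycle G
  injective-traversal⇒cycle {f} f-inj trav =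
    permutation f f⁻¹ f∘f⁻¹ (λ k → f-inj (f∘f⁻¹ (f k))) , trav
    where
    f⁻¹ : Fin n → Fin n
    f⁻¹ = proj₁ ∘ injective⇒surjective f-inj

    f∘f⁻¹ : ∀ i → f (f⁻¹ i) ≡ i
    f∘f⁻¹ = proj₂ ∘ injective⇒surjective f-inj

  -- Exhaustive search: self-maps of `Fin n` are coded by the elements of `Fin (n ℕ.^ n)`, and the
  -- injective ones are the permutations.
  hamiltonianCycle? : Dec (HamiltonianCycle G)
  hamiltonianCycle? = map′ to from (any? λ (a : Fin (n ℕ.^ n)) →
          all? (λ i → all? λ j → (finToFun a i ≟ finToFun a j) →-dec (i ≟ j))
    ×-dec traverses? (finToFun a))
    where
    to : ∃ (λ (a : Fin (n ℕ.^ n)) →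
             (∀ i j → finToFun a i ≡ finToFun a j → i ≡ j) ×
             Traverses (finToFun a)) →
         HamiltonianCycle G
    to (_ , inj , trav) = injective-traversal⇒cycle (inj _ _) trav

    from : HamiltonianCycle G →
           ∃ (λ (a : Fin (n ℕ.^ n)) →
             (∀ i j → finToFun a i ≡ finToFun a j → i ≡ j) ×
             Traverses (finToFun a))
    from (v , trav) = funToFin f
      , (λ i j eq → v-inj (≡.trans (≡.sym (f≗ i)) (≡.trans eq (f≗ j))))
      , traverses-resp-≗ (≡.sym ∘ f≗) trav
      where
      f : Fin n → Fin n
      f = v ⟨$⟩ʳ_

      f≗ : finToFun (funToFin f) ≗ f
      f≗ = finToFun-funToFin f

      v-inj : Injective _≡_ _≡_ f
      v-inj eq = ≡.trans (≡.sym (inverseˡ v))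
                         (≡.trans (cong (v ⟨$⟩ˡ_) eq) (inverseˡ v))

  -- The first n vertices of the orbit are distinct, hence exhaust the graph, and the next step must
  -- lead back to `i₀`.
  orbit⇒cycle : (s : Fin n → Fin n) → (∀ i → Arc i (s i)) → (i₀ : Fin n) →
                (∀ k m → 0 < k → k < n → fold i₀ s (k ℕ.+ m) ≢ fold i₀ s m) →
                HamiltonianCycle G
  orbit⇒cycle s s-arc i₀ noReturn =
    injective-traversal⇒cycle v-inj (steps , closing)
    where
    walk : ℕ → Fin n
    walk = fold i₀ s

    v : Fin n → Fin n
    v = walk ∘ toℕ

    -- The bounds place the gap `l ∸ k` strictly between 0 and n. The index `l` itself may reach n,
    -- as `walk-n` requires.
    walk-≢ : ∀ {k l} → k < l → l < n ℕ.+ k → walk l ≢ walk k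
    walk-≢ {k} {l} k<l l<n+k eq =
      noReturn (l ∸ k) k (ℕ.m<n⇒0<n∸m k<l) l∸k<n
        (≡.trans (cong walk l∸k+k≡l) eq)
      where
      l∸k+k≡l : l ∸ k ℕ.+ k ≡ l
      l∸k+k≡l = ℕ.m∸n+n≡m (ℕ.<⇒≤ k<l)

      l∸k<n : l ∸ k < n
      l∸k<n = ℕ.+-cancelʳ-< k (l ∸ k) n (subst (_< n ℕ.+ k) (≡.sym l∸k+k≡l) l<n+k)

    v-inj : Injective _≡_ _≡_ v
    v-inj {k} {l} eq with ℕ.<-cmp (toℕ k) (toℕ l)
    ... | tri≈ _ k≡l _ = toℕ-injective k≡l
    ... | tri< k<l _ _ = contradiction (≡.sym eq)
                           (walk-≢ k<l (ℕ.m≤n⇒m≤n+o (toℕ k) (toℕ<n l)))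
    ... | tri> _ _ l<k = contradiction eq
                           (walk-≢ l<k (ℕ.m≤n⇒m≤n+o (toℕ l) (toℕ<n k)))

    -- The n-th vertex equals some earlier one, which can only be the 0-th.
    walk-n : walk n ≡ i₀
    walk-n with injective⇒surjective v-inj (walk n)
    ... | k , eq with toℕ k in toℕk≡
    ...   | zero   = ≡.sym eq
    ...   | suc k′ = contradiction (≡.sym eq)
                       (walk-≢ (subst (_< n) toℕk≡ (toℕ<n k))
                               (ℕ.m<m+n n ℕ.z<s))

    steps : ∀ k l → toℕ l ≡ suc (toℕ k) → Arc (v k) (v l)
    steps k l eq = subst (Arc (v k) ∘ walk) (≡.sym eq) (s-arc (v k))

    closing : ∀ k l → suc (toℕ k) ≡ n → toℕ l ≡ 0 → Arc (v k) (v l)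
    closing k l eq eq₀ = subst (Arc (v k))
      (≡.trans (cong walk eq) (≡.trans walk-n (cong walk (≡.sym eq₀))))
      (s-arc (v k))

-- Arithmetic in a Heyting field.

module HeytingFieldProperties (F : HeytingField c ℓ₁ ℓ₂) where
  open FieldNotions F
  open HeytingField F using () renaming (heytingCommutativeRing to hcr)
  open CommutativeRing (HeytingCommutativeRing.commutativeRing hcr)
    using (*-monoid; ring)
  open HeytingProperties hcr using (1#0; x-0≈x)
  open RingProperties ring using (x∙y⁻¹≈ε⇒x≈y; x≈y⇒x∙y⁻¹≈ε)
  open ExpProperties semiring using (^-congˡ; ^-congʳ; ^-assocʳ)
  open import Algebra.Definitions.RawSemiring (Semiring.rawSemiring semiring)
    using (_^′_)
  open ≈-Reasoning setoid

  x-y≈0⇒x≈y : ∀ {x y} → x - y ≈ 0# → x ≈ y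
  x-y≈0⇒x≈y = x∙y⁻¹≈ε⇒x≈y _ _

  x≈y⇒x-y≈0 : ∀ {x y} → x ≈ y → x - y ≈ 0#
  x≈y⇒x-y≈0 = x≈y⇒x∙y⁻¹≈ε

  -- Bridges the power computed when `⊛` is evaluated and the one in which roots of unity are
  -- stated.
  ^′≈^ : ∀ x k → x ^′ k ≈ x ^ k
  ^′≈^ x k = sym (MultProperties.×ᵤ≈× *-monoid k x)

  1≉0 : ¬ 1# ≈ 0#
  1≉0 1≈0 = #-irrefl 1≈0 1#0

  -- Contrapositive of tightness; the double negations of the proof originate here.
  ≉⇒¬¬# : ∀ {x y} → ¬ x ≈ y → ¬ ¬ x # y
  ≉⇒¬¬# x≉y ¬x#y = x≉y (proj₁ (tight _ _) ¬x#y)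

  x#0⇒xy≈0⇒y≈0 : ∀ {x y} → x # 0# → x * y ≈ 0# → y ≈ 0#
  x#0⇒xy≈0⇒y≈0 {x} {y} x#0 xy≈0 with u , ux≈1 , _ ← #⇒invertible x#0 = begin
    y                 ≈⟨ *-identityˡ y ⟨
    1# * y            ≈⟨ *-congʳ ux≈1 ⟨
    u * (x - 0#) * y  ≈⟨ *-congʳ (*-congˡ (x-0≈x x)) ⟩
    u * x * y         ≈⟨ *-assoc u x y ⟩
    u * (x * y)       ≈⟨ *-congˡ xy≈0 ⟩
    u * 0#            ≈⟨ zeroʳ u ⟩
    0#                ∎

  1^ : ∀ k → 1# ^ k ≈ 1#
  1^ zero    = refl
  1^ (suc k) = trans (*-identityˡ _) (1^ k)

  root-^ : ∀ {x} n k → x ^ n ≈ 1# → (x ^ k) ^ n ≈ 1#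
  root-^ {x} n k xⁿ≈1 = begin
    (x ^ k) ^ n     ≈⟨ ^-assocʳ x k n ⟩
    x ^ (k ℕ.* n)   ≈⟨ ^-congʳ x (ℕ.*-comm k n) ⟩
    x ^ (n ℕ.* k)   ≈⟨ ^-assocʳ x n k ⟨
    (x ^ n) ^ k     ≈⟨ ^-congˡ k xⁿ≈1 ⟩
    1# ^ k          ≈⟨ 1^ k ⟩
    1#              ∎

  -- With n = m + 1, the power `x ^ m` is an explicit inverse of `x`, so `x` cancels.
  zx≈x⇒z≈1 : ∀ {x z} n .{{_ : NonZero n}} → x ^ n ≈ 1# → z * x ≈ x → z ≈ 1#
  zx≈x⇒z≈1 {x} {z} (suc m) xⁿ≈1 zx≈x = begin
    z                ≈⟨ *-identityʳ z ⟨
    z * 1#           ≈⟨ *-congˡ xⁿ≈1 ⟨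
    z * (x * x ^ m)  ≈⟨ *-assoc z x (x ^ m) ⟨
    z * x * x ^ m    ≈⟨ *-congʳ zx≈x ⟩
    x ^ suc m        ≈⟨ xⁿ≈1 ⟩
    1#               ∎

-- The embedding into the closure, and vanishing products.

module _ {K : HeytingField c ℓ₁ ℓ₂} (C : AlgebraicClosure K c′ ℓ₁′ ℓ₂′) where
  open AlgebraicClosure C
  private module K = FieldNotions K
  open FieldNotions K̄
  open HeytingFieldProperties K̄
  open RingMorphisms K.rawRing rawRing using (module IsRingHomomorphism)
  open IsRingHomomorphism isRingHomomorphism
  open Eval rawRing ι using (⟦_⟧)
  open ≈-Reasoning setoid

  ι-homo-^ : ∀ a k → ι (a K.^ k) ≈ ι a ^ k
  ι-homo-^ a zero    = 1#-homo
  ι-homo-^ a (suc k) = trans (*-homo a (a K.^ k)) (*-congˡ (ι-homo-^ a k))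

  -- If `a` and `b` were apart, their difference would be a unit sent to 0, forcing 1 = 0 in the
  -- closure; tightness concludes.
  ι-injective : ∀ {a b} → ι a ≈ ι b → a K.≈ b
  ι-injective {a} {b} ιa≈ιb = proj₁ (K.tight a b) λ a#b →
    case K.#⇒invertible a#b of λ (u , u[a-b]≈1 , _) → 1≉0 (begin
      1#                       ≈⟨ 1#-homo ⟨
      ι K.1#                   ≈⟨ ⟦⟧-cong u[a-b]≈1 ⟨
      ι (u K.* (a K.- b))      ≈⟨ *-homo u (a K.- b) ⟩
      ι u * ι (a K.- b)        ≈⟨ *-congˡ (+-homo a (K.- b)) ⟩
      ι u * (ι a + ι (K.- b))  ≈⟨ *-congˡ (+-congˡ (-‿homo b)) ⟩
      ι u * (ι a - ι b)        ≈⟨ *-congˡ (x≈y⇒x-y≈0 ιa≈ιb) ⟩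
      ι u * 0#                 ≈⟨ zeroʳ (ι u) ⟩
      0#                       ∎)

  ι-root : ∀ n {ω} → ω K.^ n K.≈ K.1# → ι ω ^ n ≈ 1#
  ι-root n {ω} ωⁿ≈1 =
    trans (sym (ι-homo-^ ω n)) (trans (⟦⟧-cong ωⁿ≈1) 1#-homo)

  ∏≈0 : ∀ {ρ} {fs : List (Polynomial K n)} →
        Any (λ f → ⟦ f ⟧ ρ ≈ 0#) fs → ⟦ ∏ K fs ⟧ ρ ≈ 0#
  ∏≈0 (here f≈0)  = trans (*-congʳ f≈0) (zeroˡ _)
  ∏≈0 (there any) = trans (*-congˡ (∏≈0 any)) (zeroʳ _)

  -- If no factor vanishes, each may be assumed invertible, since the goal is absurdity, and is
  -- cancelled in turn. What remains is the empty product 1, which is not 0; this also rules out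
  -- vertices without out-neighbours.
  ∏≈0⇒¬¬Any : ∀ {ρ} (fs : List (Polynomial K n)) →
              ⟦ ∏ K fs ⟧ ρ ≈ 0# → ¬ ¬ Any (λ f → ⟦ f ⟧ ρ ≈ 0#) fs
  ∏≈0⇒¬¬Any []       ι1≈0 _    = 1≉0 (trans (sym 1#-homo) ι1≈0)
  ∏≈0⇒¬¬Any (f ∷ fs) f∏≈0 ¬any = ≉⇒¬¬# (¬any ∘ here) λ f#0 →
    ∏≈0⇒¬¬Any fs (x#0⇒xy≈0⇒y≈0 f#0 f∏≈0) (¬any ∘ there)

  -- The equations of the system as conditions on vertices.

  module _ (G : SimpleDigraph n) (ω : K.Carrier) where
    open SimpleDigraph G
    open ExpProperties semiring using (^-congˡ)

    rootEquation : Fin n → Polynomial K n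
    rootEquation i = Ι i ⊛ n ⊕ ⊝ Κ K.1#

    arcFactor : Fin n → Fin n → Polynomial K n
    arcFactor i j = Κ ω ⊗ Ι i ⊕ ⊝ Ι j

    root⇒equation : ∀ (ρ : Vec Carrier n) i →
                    lookup ρ i ^ n ≈ 1# → ⟦ rootEquation i ⟧ ρ ≈ 0#
    root⇒equation ρ i xⁿ≈1 =
      x≈y⇒x-y≈0 (trans (^′≈^ (lookup ρ i) n) (trans xⁿ≈1 (sym 1#-homo)))

    equation⇒root : ∀ (ρ : Vec Carrier n) i →
                    ⟦ rootEquation i ⟧ ρ ≈ 0# → lookup ρ i ^ n ≈ 1#
    equation⇒root ρ i eq =
      trans (sym (^′≈^ (lookup ρ i) n)) (trans (x-y≈0⇒x≈y eq) 1#-homo)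

    -- An arc together with the vanishing of its `arcFactor` at `ρ`, written without subtraction.
    Successor : Vec Carrier n → Fin n → Fin n → Set ℓ₁′
    Successor ρ i j = Arc i j × ι ω * lookup ρ i ≈ lookup ρ j

    successor⇒equation : ∀ ρ i → ∃ (Successor ρ i) →
                         ⟦ ∏ K (map (arcFactor i) (δ⁺ i)) ⟧ ρ ≈ 0#
    successor⇒equation ρ i (j , i→j , ωxᵢ≈xⱼ) =
      ∏≈0 {fs = map (arcFactor i) (δ⁺ i)} (Any.map⁺
        (lose (∈-filter⁺ (arc? i) (∈-allFin j) i→j) (x≈y⇒x-y≈0 ωxᵢ≈xⱼ)))

    equation⇒¬¬successor : ∀ ρ i → ⟦ ∏ K (map (arcFactor i) (δ⁺ i)) ⟧ ρ ≈ 0# →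
                           ¬ ¬ ∃ (Successor ρ i)
    equation⇒¬¬successor ρ i eq =
      ¬¬-map fromAny (∏≈0⇒¬¬Any (map (arcFactor i) (δ⁺ i)) eq)
      where
      fromAny : Any (λ f → ⟦ f ⟧ ρ ≈ 0#) (map (arcFactor i) (δ⁺ i)) →
                ∃ (Successor ρ i)
      fromAny any with j , j∈δ⁺ , eqⱼ ← find (Any.map⁻ any) =
        j , proj₂ (∈-filter⁻ (arc? i) {xs = allFin n} j∈δ⁺) , x-y≈0⇒x≈y eqⱼ

    rootEquations : List (Polynomial K n)
    rootEquations = map rootEquation (allFin n)

    solution : (ρ : Vec Carrier n) → (∀ i → lookup ρ i ^ n ≈ 1#) →
               (∀ i → ∃ (Successor ρ i)) → HasSolutionOver C (H K G ω)
    solution ρ roots successor = ρ , All.++⁺ {xs = rootEquations}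
      (All.map⁺ (All.tabulate λ {i} _ → root⇒equation ρ i (roots i)))
      (All.map⁺ (All.tabulate λ {i} _ → successor⇒equation ρ i (successor i)))

    solution⁻ : HasSolutionOver C (H K G ω) → ∃[ ρ ]
      (∀ i → lookup ρ i ^ n ≈ 1#) × (∀ i → ¬ ¬ ∃ (Successor ρ i))
    solution⁻ (ρ , eqs) = ρ
      , (λ i → equation⇒root ρ i
          (All.lookup (All.map⁻ (All.++⁻ˡ rootEquations eqs)) (∈-allFin i)))
      , (λ i → equation⇒¬¬successor ρ i
          (All.lookup (All.map⁻ (All.++⁻ʳ rootEquations eqs)) (∈-allFin i)))

    -- From a solution to a cycle.

    solution⇒¬¬cycle : Fin n → K.PrimitiveRootOfUnity n ω →
                       HasSolutionOver C (H K G ω) → ¬ ¬ HamiltonianCycle G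
    solution⇒¬¬cycle i₀ (_ , ωᵏ≉1) sol
      with ρ , roots , ¬¬successor ← solution⁻ sol =
      -- Since there are finitely many vertices, `sequence` moves the double negation outside the
      -- quantifier and yields a whole successor function.
      ¬¬-map (λ successor → cycle (proj₁ ∘ successor) (proj₂ ∘ successor))
             (sequence (RawMonad.rawApplicative ¬¬-Monad) ¬¬successor)
      where
      x = lookup ρ

      cycle : (s : Fin n → Fin n) → (∀ i → Successor ρ i (s i)) →
              HamiltonianCycle G
      cycle s s-spec = orbit⇒cycle G s (proj₁ ∘ s-spec) i₀ noReturn
        where
        walk : ℕ → Fin n
        walk = fold i₀ s

        x-walk : ∀ k m → x (walk (k ℕ.+ m)) ≈ ι ω ^ k * x (walk m)
        x-walk zero    m = sym (*-identityˡ _)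
        x-walk (suc k) m = begin
          x (walk (suc k ℕ.+ m))            ≈⟨ proj₂ (s-spec (walk (k ℕ.+ m))) ⟨
          ι ω * x (walk (k ℕ.+ m))          ≈⟨ *-congˡ (x-walk k m) ⟩
          ι ω * (ι ω ^ k * x (walk m))      ≈⟨ *-assoc _ _ _ ⟨
          ι ω ^ suc k * x (walk m)          ∎

        -- A return would make `ι ω ^ k` fix a root of unity, hence equal 1 in the closure;
        -- `ι-injective` carries this back to `K`, where primitivity is assumed.
        noReturn : ∀ k m → 0 < k → k < n → walk (k ℕ.+ m) ≢ walk m
        noReturn k m 0<k k<n eq = ωᵏ≉1 k 0<k k<n (ι-injective (begin
          ι (ω K.^ k)  ≈⟨ ι-homo-^ ω k ⟩
          ι ω ^ k      ≈⟨ zx≈x⇒z≈1 n (roots (walk m)) (begin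
            ι ω ^ k * x (walk m)  ≈⟨ x-walk k m ⟨
            x (walk (k ℕ.+ m))    ≈⟨ reflexive (cong x eq) ⟩
            x (walk m)            ∎) ⟩
          1#           ≈⟨ 1#-homo ⟨
          ι K.1#       ∎))
          where instance _ = ℕ.>-nonZero (ℕ.<-trans 0<k k<n)

    -- From a cycle to a solution.

    cycle⇒solution : ω K.^ n K.≈ K.1# → HamiltonianCycle G →
                     HasSolutionOver C (H K G ω)
    cycle⇒solution ωⁿ≈1 (v , steps , closing) = solution ρ
      (λ i → trans (^-congˡ n (x-value i)) (root-^ n (position i) ζⁿ≈1))
      successor
      where
      ζⁿ≈1 : ι ω ^ n ≈ 1#
      ζⁿ≈1 = ι-root n ωⁿ≈1

      -- Unknowns are indexed by vertices and the cycle by positions, hence the inverse permutation.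
      position : Fin n → ℕ
      position i = toℕ (v ⟨$⟩ˡ i)

      ρ : Vec Carrier n
      ρ = tabulate λ i → ι ω ^ position i

      x-value : ∀ i → lookup ρ i ≈ ι ω ^ position i
      x-value i = reflexive (lookup∘tabulate _ i)

      x-v : ∀ k → lookup ρ (v ⟨$⟩ʳ k) ≈ ι ω ^ toℕ k
      x-v k = trans (x-value _) (reflexive (cong (λ l → ι ω ^ toℕ l) (inverseˡ v)))

      successor-v : ∀ k → ∃ (Successor ρ (v ⟨$⟩ʳ k))
      -- Positions count from 0, so `suc (toℕ k)` equals n exactly at the last vertex, whose
      -- successor lies across the closing arc.
      successor-v k with ℕ.m≤n⇒m<n∨m≡n (toℕ<n k)
      ... | inj₁ 1+k<n = v ⟨$⟩ʳ l , steps k l toℕl≡ , (begin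
        ι ω * lookup ρ (v ⟨$⟩ʳ k)  ≈⟨ *-congˡ (x-v k) ⟩
        ι ω ^ suc (toℕ k)          ≈⟨ reflexive (cong (ι ω ^_) toℕl≡) ⟨
        ι ω ^ toℕ l                ≈⟨ x-v l ⟨
        lookup ρ (v ⟨$⟩ʳ l)        ∎)
        where
        l = fromℕ< 1+k<n
        toℕl≡ = toℕ-fromℕ< 1+k<n
      -- The next power is the n-th, which wraps around to 1, the value on the first vertex.
      ... | inj₂ 1+k≡n = v ⟨$⟩ʳ l , closing k l 1+k≡n toℕl≡0 , (begin
        ι ω * lookup ρ (v ⟨$⟩ʳ k)  ≈⟨ *-congˡ (x-v k) ⟩
        ι ω ^ suc (toℕ k)          ≈⟨ reflexive (cong (ι ω ^_) 1+k≡n) ⟩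
        ι ω ^ n                    ≈⟨ ζⁿ≈1 ⟩
        1#                         ≈⟨ reflexive (cong (ι ω ^_) toℕl≡0) ⟨
        ι ω ^ toℕ l                ≈⟨ x-v l ⟨
        lookup ρ (v ⟨$⟩ʳ l)        ∎)
        where
        0<n = subst (0 <_) 1+k≡n ℕ.z<s
        l = fromℕ< 0<n
        toℕl≡0 = toℕ-fromℕ< 0<n

      successor : ∀ i → ∃ (Successor ρ i)
      successor i = subst (∃ ∘ Successor ρ) (inverseʳ v)
                          (successor-v (v ⟨$⟩ˡ i))

proposition1p3 : ∀ {c ℓ₁ ℓ₂ c′ ℓ₁′ ℓ₂′ : Level}
    (n : ℕ) (G : SimpleDigraph n)
    (K : HeytingField c ℓ₁ ℓ₂)
    (p : ℕ) → FieldNotions.HasCharacteristic K p → ¬ (p ∣ n) →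
    (ω : HeytingField.Carrier K) → FieldNotions.PrimitiveRootOfUnity K n ω →
    (K̄ : AlgebraicClosure K c′ ℓ₁′ ℓ₂′) →
    HasSolutionOver K̄ (H K G ω) ⇔ HamiltonianCycle G
-- Every `p` divides 0, so the empty graph contradicts the hypothesis on the characteristic;
-- otherwise the vertex `zero` can start the orbit.
proposition1p3 zero    _ _ p _ p∤n _ _ _ = contradiction (p ∣0) p∤n
proposition1p3 (suc _) G _ _ _ _ ω ω-prim K̄ = mk⇔
  (λ sol → decidable-stable (hamiltonianCycle? G)
    (solution⇒¬¬cycle K̄ G ω zero ω-prim sol))
  (cycle⇒solution K̄ G ω (proj₁ ω-prim))
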